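{- Let $d\ge 2$ be an integer. Let $H$ be a connected graph with maximum degree $d$ and $N$ vertices, where $N>d^{d^{d^d}}$, and let $U\subseteq V(H)$. Then there exists a graph $G$ such that $N\le|V(G)|\le 2^{d^{21d+20}}N$, the maximum degree of $G$ is at most $d\,2^{d^{21d+20}}$, and there are at least $2^{|V(G)|/2^{d^{21d+20}}}$ sets $S\subseteq V(G)$ such that $G[S]$ is a maximal $U$-clique prescribed blow-up of $H$.
   Context: All graphs are finite and simple. With $V(H)=\{1,\dots,k\}$, a $U$-clique prescribed blow-up of $H$ is a graph whose vertex set is partitioned into nonempty sets $V_1\sqcup\dots\sqcup V_k$ such that $V_i$ is complete to $V_j$ whenever $ij\in E(H)$ and $V_i$ is a clique for each $i\in U$. For $S\subseteq V(G)$, $G[S]$ is a maximal such blow-up if $G[S]$ is one and there is no $S'$ with $S\subsetneq S'\subseteq V(G)$ such that $G[S']$ is one. -}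

module Defs where

open import Data.Nat using (ℕ; _≤_)
open import Data.Bool using (Bool; true; false)
open import Data.Fin using (Fin)
open import Data.Fin.Subset using (Subset; _∈_; _⊂_; ∣_∣)
open import Data.Vec using (tabulate)
open import Data.Product using (Σ; ∃; _×_; _,_)
open import Relation.Binary.PropositionalEquality using (_≡_)
open import Relation.Nullary using (¬_)

record Graph (n : ℕ) : Set where
  field
    adj   : Fin n → Fin n → Bool
    sym   : ∀ u v → adj u v ≡ adj v u
    irref : ∀ v → adj v v ≡ false

open Graph public

Adj : ∀ {n} → Graph n → Fin n → Fin n → Set
Adj G u v = adj G u v ≡ true

degree : ∀ {n} → Graph n → Fin n → ℕ
degree G v = ∣ tabulate (adj G v) ∣

MaxDegree≤ : ∀ {n} → Graph n → ℕ → Set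
MaxDegree≤ G d = ∀ v → degree G v ≤ d

MaxDegree≡ : ∀ {n} → Graph n → ℕ → Set
MaxDegree≡ G d = MaxDegree≤ G d × ∃ λ v → degree G v ≡ d

data Reach {n} (G : Graph n) : Fin n → Fin n → Set where
  here : ∀ {v} → Reach G v v
  step : ∀ {u v w} → Adj G u v → Reach G v w → Reach G u w

Connected : ∀ {n} → Graph n → Set
Connected G = ∀ u v → Reach G u v

-- G[S] is a U-clique prescribed blow-up of H (V(H) = Fin k):
-- f assigns each vertex of S to its part V_{f v}; all parts nonempty;
-- V_i complete to V_j for ij ∈ E(H); V_i a clique for i ∈ U.
IsBlowup : ∀ {k n} → Graph k → Subset k → Graph n → Subset n → Set
IsBlowup {k} {n} H U G S =
  Σ (Fin n → Fin k) λ f →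
    (∀ i → ∃ λ v → v ∈ S × f v ≡ i)
    × (∀ u v → u ∈ S → v ∈ S → Adj H (f u) (f v) → Adj G u v)
    × (∀ u v → u ∈ S → v ∈ S → f u ∈ U → f u ≡ f v → ¬ (u ≡ v) → Adj G u v)

IsMaximalBlowup : ∀ {k n} → Graph k → Subset k → Graph n → Subset n → Set
IsMaximalBlowup H U G S =
  IsBlowup H U G S × (∀ S' → S ⊂ S' → ¬ IsBlowup H U G S')

{-# OPTIONS --safe #-}
-- Let C = 2 ^ (d ^ (21 * d + 20)), and let Z ⊆ V(H) be a maximal set of vertices with
-- pairwise disjoint closed neighbourhoods, so that N ≤ |Z| (d + 1)².  Take C copies of
-- every vertex of H and join (v , a) to (w , b) when v ~ w in H and, if v or w lies in
-- Z, moreover a = b.  A choice of a colour for each z ∈ Z, extended to the closed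
-- neighbourhood of z, gives a transversal that spans a copy of H, hence extends to a
-- maximal blow-up T.  Conversely, if T contains the copy (z , a), then some part of T
-- lies in the neighbourhood of (z , a), and these neighbourhoods are pairwise disjoint.
-- So T contains at most N copies of vertices of Z, and the choices that extend to T
-- are determined by subsets of an N-element set.  Hence there are at least
-- C ^ |Z| / 2 ^ N ≥ 2 ^ N maximal blow-ups.
module Submission where

open import Defs renaming (sym to adj-sym)
open import Data.Nat using (ℕ; zero; suc; z≤n; s≤s; _≤_; _<_; _+_; _*_; _^_)
open import Data.Nat.Properties
open import Data.Bool using (Bool; true; false)
import Data.Bool.Properties as Bool
open import Data.Fin using (Fin; zero; suc; combine; remQuot; fromℕ<)
import Data.Fin.Properties as Fin
open import Data.Fin.Subset using (Subset; _∈_; _⊆_; _⊂_; _⊃_; ∣_∣)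
open import Data.Fin.Subset.Induction using (⊃-wellFounded)
open import Data.Fin.Subset.Properties
  using (_∈?_; _⊂?_; anySubset?; ⊆-refl; ⊆-trans)
open import Data.List using (List; []; _∷_; length; map; filter; concatMap; lookup; allFin
                            ; cartesianProductWith; cartesianProduct)
import Data.List as List
open import Data.List.Properties using (length-map; length-++; length-tabulate)
import Data.List.Membership.DecPropositional as DecMembership
open import Data.List.Membership.Propositional using (lose) renaming (_∈_ to _∈ˡ_)
open import Data.List.Membership.Propositional.Properties
  using ( ∈-lookup; ∈-filter⁺; ∈-filter⁻; ∈-allFin; ∈-concatMap⁺; ∈-cartesianProduct⁺
        ; ∈-cartesianProductWith⁺)
open import Data.List.Membership.Setoid.Properties using (index-injective)
open import Data.List.Relation.Unary.All using (All; []; _∷_)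
import Data.List.Relation.Unary.All as All
open import Data.List.Relation.Unary.All.Properties using (all-filter; ¬Any⇒All¬)
open import Data.List.Relation.Unary.AllPairs using (AllPairs; []; _∷_)
open import Data.List.Relation.Unary.Any using (Any; here; there; any?; index; satisfied)
import Data.List.Relation.Unary.Any as Any
open import Data.List.Relation.Unary.Unique.Propositional using (Unique)
import Data.List.Relation.Unary.Unique.Propositional.Properties as Unique
open import Data.Product using (Σ; ∃; ∃-syntax; _×_; _,_; proj₁; proj₂)
open import Data.Sum using (_⊎_; inj₁; inj₂) renaming ([_,_]′ to [_,_])
open import Data.Vec using (Vec; []; _∷_; tabulate)
import Data.Vec as Vec
open import Data.Vec.Properties
  using (lookup∘tabulate; tabulate∘lookup; tabulate-cong; []=⇒lookup; lookup⇒[]=; ∷-injective)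
open import Function using (_∘_; id; mk⇔)
open import Induction.WellFounded using (Acc; acc)
open import Level using (Level)
open import Relation.Binary using (Rel; Reflexive; Symmetric)
import Relation.Binary as B
open import Relation.Binary.PropositionalEquality
  using (_≡_; _≢_; _≗_; refl; sym; trans; cong; cong₂; subst; setoid)
open import Relation.Nullary using (¬_; Dec; yes; no; does; ¬?; contradiction)
open import Relation.Nullary.Decidable
  using (_×-dec_; _⊎-dec_; _→-dec_; dec-true; dec-false; does-⇔)
open import Relation.Unary using (Pred; Decidable)

private
  variable
    ℓ : Level
    A B C : Set
    n k : ℕ

-- Counting with lists.

-- `AllPairs` relates an earlier entry to a later one only; symmetry supplies the reversed order.
AllPairs-lookup : {R : Rel A ℓ} → Symmetric R → ∀ {xs} → AllPairs R xs →
                  ∀ i j → i ≡ j ⊎ R (lookup xs i) (lookup xs j)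
AllPairs-lookup R-sym {_ ∷ _}  (_  ∷ _)   zero    zero    = inj₁ refl
AllPairs-lookup R-sym {_ ∷ xs} (px ∷ _)   zero    (suc j) = inj₂ (All.lookup px (∈-lookup {xs = xs} j))
AllPairs-lookup R-sym {_ ∷ xs} (px ∷ _)   (suc i) zero    = inj₂ (R-sym (All.lookup px (∈-lookup {xs = xs} i)))
AllPairs-lookup R-sym {_ ∷ _}  (_  ∷ pxs) (suc i) (suc j) =
  [ inj₁ ∘ cong suc , inj₂ ] (AllPairs-lookup R-sym pxs i j)

-- Pigeonhole on positions: each position of `xs` goes to the position in `ys` where the image under
-- `f` is found. Uniqueness of `xs` turns equal entries back into equal positions.
length-≤-injectiveOn : {xs : List A} {ys : List B} (f : A → B) → Unique xs →
                       (∀ {x y} → x ∈ˡ xs → y ∈ˡ xs → f x ≡ f y → x ≡ y) →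
                       (∀ {x} → x ∈ˡ xs → f x ∈ˡ ys) → length xs ≤ length ys
length-≤-injectiveOn {B = B} {xs = xs} f unique inj f∈ys =
  Fin.injective⇒≤ {f = λ i → index (f∈ys (∈-lookup {xs = xs} i))} λ {i} {j} eq →
    [ id , contradiction (inj (∈-lookup i) (∈-lookup j)
             (index-injective (setoid B) (f∈ys (∈-lookup i)) (f∈ys (∈-lookup j)) eq)) ]
    (AllPairs-lookup (λ x≢y → x≢y ∘ sym) unique i j)

length-cartesianProductWith : (f : A → B → C) (xs : List A) (ys : List B) →
                              length (cartesianProductWith f xs ys) ≡ length xs * length ys
length-cartesianProductWith f []       ys = refl
length-cartesianProductWith f (x ∷ xs) ys = trans (length-++ (map (f x) ys))
  (cong₂ _+_ (length-map (f x) ys) (length-cartesianProductWith f xs ys))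

length-concatMap-≤ : (f : A → List B) {c : ℕ} → (∀ x → length (f x) ≤ c) →
                     ∀ xs → length (concatMap f xs) ≤ length xs * c
length-concatMap-≤ f f≤ []       = z≤n
length-concatMap-≤ f f≤ (x ∷ xs) = ≤-trans (≤-reflexive (length-++ (f x)))
  (+-mono-≤ (f≤ x) (length-concatMap-≤ f f≤ xs))

length-allFin : ∀ n → length (allFin n) ≡ n
length-allFin n = length-tabulate id

module _ {R : Rel A ℓ} (R? : B.Decidable R) (R-refl : Reflexive R) where

  -- Greedy choice: an entry is kept exactly when it is not related to anything kept so far, and a
  -- rejected entry is covered by what caused its rejection.
  maximal-packing : ∀ xs → ∃[ zs ] AllPairs (λ x y → ¬ R x y) zs × All (λ x → Any (R x) zs) xs
  maximal-packing []       = [] , [] , []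
  maximal-packing (x ∷ xs) with maximal-packing xs
  ... | zs , sep , cover with any? (R? x) zs
  ...   | yes close = zs , sep , close ∷ cover
  ...   | no ¬close = x ∷ zs , ¬Any⇒All¬ zs ¬close ∷ sep , here R-refl ∷ All.map there cover

-- Enumeration of vectors and subsets.

vecs : List A → ∀ n → List (Vec A n)
vecs xs zero    = [] ∷ []
vecs xs (suc n) = cartesianProductWith _∷_ xs (vecs xs n)

length-vecs : (xs : List A) → ∀ n → length (vecs xs n) ≡ length xs ^ n
length-vecs xs zero    = refl
length-vecs xs (suc n) = trans (length-cartesianProductWith _∷_ xs (vecs xs n))
  (cong (length xs *_) (length-vecs xs n))

vecs-unique : {xs : List A} → Unique xs → ∀ n → Unique (vecs xs n)
vecs-unique unique zero    = [] ∷ []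
vecs-unique unique (suc n) =
  Unique.cartesianProductWith⁺ _∷_ ∷-injective unique (vecs-unique unique n)

∈-vecs : {xs : List A} → (∀ x → x ∈ˡ xs) → ∀ {n} (v : Vec A n) → v ∈ˡ vecs xs n
∈-vecs ∈xs []      = here refl
∈-vecs ∈xs (x ∷ v) = ∈-cartesianProductWith⁺ _∷_ (∈xs x) (∈-vecs ∈xs v)

bools : List Bool
bools = true ∷ false ∷ []

bools-unique : Unique bools
bools-unique = ((λ ()) ∷ []) ∷ [] ∷ []

∈-bools : ∀ b → b ∈ˡ bools
∈-bools true  = here refl
∈-bools false = there (here refl)

subsets : ∀ n → List (Subset n)
subsets = vecs bools

comprehension : {P : Pred (Fin n) ℓ} → Decidable P → Subset n
comprehension P? = tabulate (does ∘ P?)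

does-true : {P : Set ℓ} (P? : Dec P) → does P? ≡ true → P
does-true (yes p) _ = p

module _ {P : Pred (Fin n) ℓ} (P? : Decidable P) where

  ∈-comprehension⁺ : ∀ {x} → P x → x ∈ comprehension P?
  ∈-comprehension⁺ {x} p = lookup⇒[]= x _ (trans (lookup∘tabulate (does ∘ P?) x) (dec-true (P? x) p))

  ∈-comprehension⁻ : ∀ {x} → x ∈ comprehension P? → P x
  ∈-comprehension⁻ {x} x∈ =
    does-true (P? x) (trans (sym (lookup∘tabulate (does ∘ P?) x)) ([]=⇒lookup x∈))

-- The extra function `g` makes the induction go through, since the tail replaces `g` by `g ∘ suc`;
-- the uses take `g = id`.
∣tabulate∣ : (f : A → Bool) (g : Fin n → A) →
             ∣ tabulate (f ∘ g) ∣ ≡ length (filter (λ x → f x Bool.≟ true) (List.tabulate g))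
∣tabulate∣ {n = zero}  f g = refl
∣tabulate∣ {n = suc n} f g with f (g zero)
... | true  = cong suc (∣tabulate∣ f (g ∘ suc))
... | false = ∣tabulate∣ f (g ∘ suc)

-- Deciding and extending blow-ups.

-- The search runs over tables of values. A function agrees with the lookup of its table only
-- pointwise, so `P` has to respect `_≗_`.
any-function? : {P : (Fin n → Fin k) → Set} → Decidable P →
                (∀ {f g} → f ≗ g → P f → P g) → Dec (∃ P)
any-function? {n} {k} {P} P? resp with any? (P? ∘ Vec.lookup) (vecs (allFin k) n)
... | yes p = yes (Vec.lookup (proj₁ (satisfied p)) , proj₂ (satisfied p))
... | no ¬p = no λ (f , Pf) →
  ¬p (lose (∈-vecs ∈-allFin (tabulate f)) (resp (λ i → sym (lookup∘tabulate f i)) Pf))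

module _ (H : Graph k) (U : Subset k) (G : Graph n) where

  IsBlowup? : Decidable (IsBlowup H U G)
  IsBlowup? S = any-function?
    (λ f → Fin.all? (λ i → Fin.any? λ v → v ∈? S ×-dec f v Fin.≟ i)
     ×-dec Fin.all? (λ u → Fin.all? λ v → u ∈? S →-dec v ∈? S →-dec
             adj H (f u) (f v) Bool.≟ true →-dec adj G u v Bool.≟ true)
     ×-dec Fin.all? (λ u → Fin.all? λ v → u ∈? S →-dec v ∈? S →-dec f u ∈? U →-dec
             f u Fin.≟ f v →-dec ¬? (u Fin.≟ v) →-dec adj G u v Bool.≟ true))
    λ f≗g (nonempty , complete , clique) →
      (λ i → let v , v∈S , fv≡i = nonempty i in v , v∈S , trans (sym (f≗g v)) fv≡i) ,
      (λ u v u∈S v∈S uv → complete u v u∈S v∈S (trans (cong₂ (adj H) (f≗g u) (f≗g v)) uv)) ,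
      (λ u v u∈S v∈S gu∈U gu≡gv → clique u v u∈S v∈S (subst (_∈ U) (sym (f≗g u)) gu∈U)
                                    (trans (f≗g u) (trans gu≡gv (sym (f≗g v)))))

  larger-blowup? : ∀ S → Dec (∃[ T ] S ⊂ T × IsBlowup H U G T)
  larger-blowup? S = anySubset? λ T → S ⊂? T ×-dec IsBlowup? T

  IsMaximalBlowup? : Decidable (IsMaximalBlowup H U G)
  IsMaximalBlowup? S with IsBlowup? S | larger-blowup? S
  ... | no ¬b | _                  = no (¬b ∘ proj₁)
  ... | yes b | yes (T , S⊂T , b′) = no λ (_ , maximal) → maximal T S⊂T b′
  ... | yes b | no ¬larger         = yes (b , λ T S⊂T b′ → ¬larger (T , S⊂T , b′))

  -- As long as a strictly larger blow-up exists, pass to it; strict inclusion of subsets of a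
  -- finite set admits no infinite ascent.
  maximal-superset : ∀ S → IsBlowup H U G S → ∃[ T ] S ⊆ T × IsMaximalBlowup H U G T
  maximal-superset S = extend S (⊃-wellFounded S)
    where
    extend : ∀ S → Acc _⊃_ S → IsBlowup H U G S → ∃[ T ] S ⊆ T × IsMaximalBlowup H U G T
    extend S (acc rec) b with larger-blowup? S
    ... | no ¬larger             = S , ⊆-refl , b , λ T S⊂T b′ → ¬larger (T , S⊂T , b′)
    ... | yes (S′ , S⊂S′ , b′) =
      let T , S′⊆T , maximal = extend S′ (rec S⊂S′) b′
      in T , ⊆-trans (proj₁ S⊂S′) S′⊆T , maximal

  maximalBlowups : List (Subset n)
  maximalBlowups = filter IsMaximalBlowup? (subsets n)

  maximalBlowups-unique : Unique maximalBlowups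
  maximalBlowups-unique = Unique.filter⁺ IsMaximalBlowup? (vecs-unique bools-unique n)

  ∈-maximalBlowups : ∀ {S} → IsMaximalBlowup H U G S → S ∈ˡ maximalBlowups
  ∈-maximalBlowups {S} = ∈-filter⁺ IsMaximalBlowup? (∈-vecs ∈-bools S)

-- Neighbourhoods and packings in a graph.

Adj-sym : (G : Graph n) → ∀ {u v} → Adj G u v → Adj G v u
Adj-sym G {u} {v} = trans (adj-sym G v u)

-- The first edge of a walk to some other vertex, which exists because there are at least two
-- vertices.
neighbour : (G : Graph n) → Connected G → 2 ≤ n → ∀ v → ∃ (Adj G v)
neighbour {n = suc (suc n)} G connected (s≤s (s≤s z≤n)) = λ
  { zero    → first (connected zero (suc zero)) λ ()
  ; (suc v) → first (connected (suc v) zero) λ ()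
  }
  where
  first : ∀ {u v} → Reach G u v → u ≢ v → ∃ (Adj G u)
  first here        u≢u = contradiction refl u≢u
  first (step uw _) _   = _ , uw

module ClosedNeighbourhoods (H : Graph n) where

  neighbours : Fin n → List (Fin n)
  neighbours v = filter (λ w → adj H v w Bool.≟ true) (allFin n)

  N[_] : Fin n → List (Fin n)
  N[ v ] = v ∷ neighbours v

  ∈-neighbours : ∀ {v w} → Adj H v w → w ∈ˡ neighbours v
  ∈-neighbours {v} {w} vw = ∈-filter⁺ (λ w → adj H v w Bool.≟ true) (∈-allFin w) vw

  N[]-sym : ∀ {v w} → w ∈ˡ N[ v ] → v ∈ˡ N[ w ]
  N[]-sym (here refl) = here refl
  N[]-sym {v} (there w∈) =
    there (∈-neighbours (Adj-sym H (proj₂ (∈-filter⁻ (λ w → adj H v w Bool.≟ true) {xs = allFin n} w∈))))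

  open DecMembership (Fin._≟_ {n}) using () renaming (_∈?_ to _∈ˡ?_) public

  -- Distance at most two.
  Close : Fin n → Fin n → Set
  Close u v = ∃[ w ] w ∈ˡ N[ u ] × w ∈ˡ N[ v ]

  Close? : B.Decidable Close
  Close? u v = Fin.any? λ w → w ∈ˡ? N[ u ] ×-dec w ∈ˡ? N[ v ]

  Close-refl : Reflexive Close
  Close-refl {v} = v , here refl , here refl

  Close-sym : Symmetric Close
  Close-sym (w , w∈N[u] , w∈N[v]) = w , w∈N[v] , w∈N[u]

  module _ {d : ℕ} (maxDegree : MaxDegree≤ H d) where

    length-neighbours : ∀ v → length (neighbours v) ≤ d
    length-neighbours v = ≤-trans (≤-reflexive (sym (∣tabulate∣ (adj H v) id))) (maxDegree v)

    -- Every vertex lies in a ball of radius two around some entry of `zs`. Such a ball is a union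
    -- of at most `suc d` closed neighbourhoods, each with at most `suc d` vertices.
    length-cover : ∀ {zs} → All (λ v → Any (Close v) zs) (allFin n) →
                   n ≤ length zs * (suc d * suc d)
    length-cover {zs} cover = begin
      n
        ≡⟨ length-allFin n ⟨
      length (allFin n)
        ≤⟨ length-≤-injectiveOn id (Unique.allFin⁺ n) (λ _ _ → id)
             (λ v∈ → ∈-concatMap⁺ _ (Any.map ∈-ball (All.lookup cover v∈))) ⟩
      length (concatMap ball zs)
        ≤⟨ length-concatMap-≤ ball length-ball zs ⟩
      length zs * (suc d * suc d) ∎
      where
      open ≤-Reasoning
      ball : Fin n → List (Fin n)
      ball z = concatMap N[_] N[ z ]
      ∈-ball : ∀ {v z} → Close v z → v ∈ˡ ball z
      ∈-ball (w , w∈N[v] , w∈N[z]) = ∈-concatMap⁺ _ (lose w∈N[z] (N[]-sym w∈N[v]))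
      length-ball : ∀ z → length (ball z) ≤ suc d * suc d
      length-ball z = ≤-trans (length-concatMap-≤ N[_] (λ w → s≤s (length-neighbours w)) N[ z ])
        (*-monoˡ-≤ (suc d) (s≤s (length-neighbours z)))

-- The coloured graph.

module Coloured {N : ℕ} (H : Graph N) (q t : ℕ) (z : Fin t → Fin N) where

  open ClosedNeighbourhoods H

  vertex : Fin (N * q) → Fin N
  vertex u = proj₁ (remQuot q u)

  colour : Fin (N * q) → Fin q
  colour u = proj₂ (remQuot {N} q u)

  vertex-combine : ∀ v a → vertex (combine v a) ≡ v
  vertex-combine v a = cong proj₁ (Fin.remQuot-combine {N} v a)

  colour-combine : ∀ v a → colour (combine v a) ≡ a
  colour-combine v a = cong proj₂ (Fin.remQuot-combine {N} v a)

  Centre : Fin N → Set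
  Centre v = ∃[ g ] v ≡ z g

  Centre? : Decidable Centre
  Centre? v = Fin.any? λ g → v Fin.≟ z g

  -- Matching colours at a centre forces all neighbours of a centre copy to share its colour, so
  -- copies of one centre have disjoint neighbourhoods. Joining all colours elsewhere lets distinct
  -- centres be coloured independently.
  Linked : Fin (N * q) → Fin (N * q) → Set
  Linked u w = Adj H (vertex u) (vertex w) ×
               (Centre (vertex u) ⊎ Centre (vertex w) → colour u ≡ colour w)

  Linked? : B.Decidable Linked
  Linked? u w = adj H (vertex u) (vertex w) Bool.≟ true ×-dec
    ((Centre? (vertex u) ⊎-dec Centre? (vertex w)) →-dec colour u Fin.≟ colour w)

  Linked-sym : ∀ u w → Linked u w → Linked w u
  Linked-sym u w (vw , same) = Adj-sym H vw , λ c → sym (same ([ inj₂ , inj₁ ] c))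

  G : Graph (N * q)
  G = record
    { adj   = λ u w → does (Linked? u w)
    ; sym   = λ u w → does-⇔ (mk⇔ (Linked-sym u w) (Linked-sym w u)) (Linked? u w) (Linked? w u)
    ; irref = λ u → dec-false (Linked? u u)
                (λ (vv , _) → contradiction (trans (sym vv) (irref H (vertex u))) λ ())
    }

  Adj⇒Linked : ∀ u w → Adj G u w → Linked u w
  Adj⇒Linked u w = does-true (Linked? u w)

  Linked⇒Adj : ∀ u w → Linked u w → Adj G u w
  Linked⇒Adj u w = dec-true (Linked? u w)

  -- A neighbour of `u` is determined by its vertex, a neighbour of `vertex u` in `H`, and its
  -- colour.
  G-maxDegree : ∀ {d} → MaxDegree≤ H d → MaxDegree≤ G (d * q)
  G-maxDegree {d} maxDegree u = begin
    degree G u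
      ≡⟨ ∣tabulate∣ (adj G u) id ⟩
    length (filter adjacent? (allFin (N * q)))
      ≤⟨ length-≤-injectiveOn (remQuot q) (Unique.filter⁺ adjacent? (Unique.allFin⁺ (N * q)))
           (λ {x} {y} _ _ → remQuot-injective x y) ∈-neighbours×colours ⟩
    length (cartesianProduct (neighbours (vertex u)) (allFin q))
      ≡⟨ length-cartesianProductWith _,_ (neighbours (vertex u)) (allFin q) ⟩
    length (neighbours (vertex u)) * length (allFin q)
      ≤⟨ *-mono-≤ (length-neighbours maxDegree (vertex u)) (≤-reflexive (length-allFin q)) ⟩
    d * q ∎
    where
    open ≤-Reasoning
    adjacent? : Decidable (Adj G u)
    adjacent? w = adj G u w Bool.≟ true
    ∈-neighbours×colours : ∀ {w} → w ∈ˡ filter adjacent? (allFin (N * q)) →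
                           remQuot q w ∈ˡ cartesianProduct (neighbours (vertex u)) (allFin q)
    ∈-neighbours×colours {w} w∈ =
      let _ , uw = ∈-filter⁻ adjacent? {xs = allFin (N * q)} w∈
      in ∈-cartesianProduct⁺ (∈-neighbours (proj₁ (Adj⇒Linked u w uw))) (∈-allFin _)
    remQuot-injective : ∀ x y → remQuot {N} q x ≡ remQuot q y → x ≡ y
    remQuot-injective x y eq = trans (sym (Fin.combine-remQuot {N} q x))
      (trans (cong (λ p → combine (proj₁ p) (proj₂ p)) eq) (Fin.combine-remQuot {N} q y))

  -- Transversals from colour choices.

  module _ (a₀ : Fin q) (separated : ∀ {i j} → Close (z i) (z j) → i ≡ j) where

    spread : Vec (Fin q) t → Fin N → Fin q
    spread s v with Fin.any? (λ g → v ∈ˡ? N[ z g ])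
    ... | yes (g , _) = Vec.lookup s g
    -- An arbitrary default: no edge at such a vertex meets a centre, so no edge constrains its
    -- colour.
    ... | no _        = a₀

    spread-∈ : ∀ s {v} g → v ∈ˡ N[ z g ] → spread s v ≡ Vec.lookup s g
    spread-∈ s {v} g v∈ with Fin.any? (λ g → v ∈ˡ? N[ z g ])
    -- The search may return an index other than `g`; as `v` lies in both closed neighbourhoods,
    -- separation identifies the two.
    ... | yes (g′ , v∈′) = cong (Vec.lookup s) (separated (v , v∈′ , v∈))
    ... | no ∉           = contradiction (g , v∈) ∉

    spread-centre : ∀ s {v w} → Adj H v w → Centre v → spread s v ≡ spread s w
    spread-centre s vw (g , refl) =
      trans (spread-∈ s g (here refl)) (sym (spread-∈ s g (there (∈-neighbours vw))))

    transversal? : ∀ s → Decidable (λ u → colour u ≡ spread s (vertex u))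
    transversal? s u = colour u Fin.≟ spread s (vertex u)

    transversal : Vec (Fin q) t → Subset (N * q)
    transversal s = comprehension (transversal? s)

    combine-∈-transversal : ∀ s v → combine v (spread s v) ∈ transversal s
    combine-∈-transversal s v = ∈-comprehension⁺ (transversal? s)
      (trans (colour-combine v _) (cong (spread s) (sym (vertex-combine v _))))

    -- The part map is `vertex`. An edge at a centre has both ends in one closed neighbourhood,
    -- where `spread s` is constant. Each part is a single copy, so the clique condition holds for
    -- every `U`.
    transversal-blowup : ∀ U s → IsBlowup H U G (transversal s)
    transversal-blowup U s = vertex ,
      (λ v → combine v (spread s v) , combine-∈-transversal s v , vertex-combine v _) ,
      (λ u w u∈ w∈ vw → Linked⇒Adj u w (vw , λ c →
        trans (∈-comprehension⁻ (transversal? s) u∈)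
          (trans ([ spread-centre s vw , sym ∘ spread-centre s (Adj-sym H vw) ] c)
                 (sym (∈-comprehension⁻ (transversal? s) w∈))))) ,
      (λ u w u∈ w∈ _ same u≢w → contradiction
        (trans (sym (Fin.combine-remQuot {N} q u))
          (trans (cong₂ combine same
                   (trans (∈-comprehension⁻ (transversal? s) u∈)
                     (trans (cong (spread s) same) (sym (∈-comprehension⁻ (transversal? s) w∈)))))
                 (Fin.combine-remQuot {N} q w)))
        u≢w)

    -- Recovering a colour choice from a maximal blow-up.

    module _ (nbr : ∀ v → ∃ (Adj H v)) (U : Subset N) where

      centreCopy : Fin t → Fin q → Fin (N * q)
      centreCopy g a = combine (z g) a

      module _ {T : Subset (N * q)} (blowup : IsBlowup H U G T) where

        private
          f : Fin (N * q) → Fin N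
          f = proj₁ blowup

          part : Fin t → Fin q → Fin N
          part g a = proj₁ (nbr (f (centreCopy g a)))

        -- A part next to the part of a centre copy consists of neighbours of that copy,
        -- so it determines the copy.
        part-injective : ∀ {g a g′ a′} → centreCopy g a ∈ T → centreCopy g′ a′ ∈ T →
                         part g a ≡ part g′ a′ → g ≡ g′ × a ≡ a′
        part-injective {g} {a} {g′} {a′} ∈T ∈T′ eq =
          separated (vertex u , proj₁ (near g a ∈T refl) , proj₁ (near g′ a′ ∈T′ (sym eq))) ,
          trans (proj₂ (near g a ∈T refl)) (sym (proj₂ (near g′ a′ ∈T′ (sym eq))))
          where
          nonempty : ∀ v → ∃[ u ] u ∈ T × f u ≡ v
          nonempty = proj₁ (proj₂ blowup)
          -- Any member of the common part: its vertex witnesses that the two closed neighbourhoods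
          -- meet, so `separated` identifies the centres.
          u : Fin (N * q)
          u = proj₁ (nonempty (part g a))
          -- Stated for a general copy so that it serves both. The copy is adjacent to `u` by
          -- completeness between parts, and this edge preserves colour because `z h` is a centre.
          near : ∀ h b → centreCopy h b ∈ T → part h b ≡ part g a →
                 vertex u ∈ˡ N[ z h ] × b ≡ colour u
          near h b c∈T same =
            let _ , u∈T , fu≡part = nonempty (part g a)
                vw , same-colour = Adj⇒Linked (centreCopy h b) u
                  (proj₁ (proj₂ (proj₂ blowup)) _ u c∈T u∈T
                    (subst (Adj H (f (centreCopy h b))) (trans same (sym fu≡part))
                      (proj₂ (nbr (f (centreCopy h b))))))
            in there (∈-neighbours (subst (λ v → Adj H v (vertex u)) (vertex-combine (z h) b) vw)) ,
               trans (sym (colour-combine (z h) b)) (same-colour (inj₁ (h , vertex-combine (z h) b)))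

        private
          used? : ∀ s → Decidable (λ v → ∃[ g ] v ≡ part g (Vec.lookup s g))
          used? s v = Fin.any? λ g → v Fin.≟ part g (Vec.lookup s g)

        usedParts : Vec (Fin q) t → Subset N
        usedParts s = comprehension (used? s)

        -- The set forgets which centre produced which part, but `part-injective` recovers it: the
        -- part of `g` under `s` must come from some `g′` under `s′`, and then both centre and
        -- colour agree.
        usedParts-injective : ∀ {s s′} →
          (∀ g → centreCopy g (Vec.lookup s g) ∈ T) → (∀ g → centreCopy g (Vec.lookup s′ g) ∈ T) →
          usedParts s ≡ usedParts s′ → s ≡ s′
        usedParts-injective {s} {s′} s∈ s′∈ eq =
          trans (sym (tabulate∘lookup s)) (trans (tabulate-cong agree) (tabulate∘lookup s′))
          where
          agree : Vec.lookup s ≗ Vec.lookup s′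
          agree g =
            let g′ , same = ∈-comprehension⁻ (used? s′)
                              (subst (part g (Vec.lookup s g) ∈_) eq (∈-comprehension⁺ (used? s) (g , refl)))
                g≡g′ , a≡a′ = part-injective (s∈ g) (s′∈ g′) same
            in trans a≡a′ (cong (Vec.lookup s′) (sym g≡g′))

      -- Two choices with the same hull may reach it with different part maps. Taking the part map
      -- from a decision about `T` makes it depend on `T` alone, so that codes can be compared. The
      -- second clause is a filler, since hulls are blow-ups.
      code : ∀ {T} → Dec (IsBlowup H U G T) → Vec (Fin q) t → Subset N
      code (yes b) s = usedParts b s
      code (no _)  s = tabulate (λ _ → false)

      hull : ∀ s → ∃[ T ] transversal s ⊆ T × IsMaximalBlowup H U G T
      hull s = maximal-superset H U G (transversal s) (transversal-blowup U s)

      centreCopy∈hull : ∀ s g → centreCopy g (Vec.lookup s g) ∈ proj₁ (hull s)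
      centreCopy∈hull s g = proj₁ (proj₂ (hull s))
        (subst (λ a → combine (z g) a ∈ transversal s) (spread-∈ s g (here refl))
          (combine-∈-transversal s (z g)))

      encode : Vec (Fin q) t → Subset (N * q) × Subset N
      encode s = proj₁ (hull s) , code (IsBlowup? H U G (proj₁ (hull s))) s

      code-injective : ∀ {T} (b? : Dec (IsBlowup H U G T)) → IsBlowup H U G T → ∀ {s s′} →
        (∀ g → centreCopy g (Vec.lookup s g) ∈ T) → (∀ g → centreCopy g (Vec.lookup s′ g) ∈ T) →
        code b? s ≡ code b? s′ → s ≡ s′
      code-injective (yes b) _ s∈ s′∈ same = usedParts-injective b s∈ s′∈ same
      code-injective (no ¬b) b _  _   _    = contradiction b ¬b

      encode-injective : ∀ {s s′} → encode s ≡ encode s′ → s ≡ s′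
      encode-injective {s} {s′} eq = go (cong proj₁ eq) (cong proj₂ eq)
          (centreCopy∈hull s) (centreCopy∈hull s′) (proj₁ (proj₂ (proj₂ (hull s))))
        where
        -- The hulls are replaced by variables so that their equality can be matched with `refl`.
        go : ∀ {T T′} → T ≡ T′ → code (IsBlowup? H U G T) s ≡ code (IsBlowup? H U G T′) s′ →
             (∀ g → centreCopy g (Vec.lookup s g) ∈ T) → (∀ g → centreCopy g (Vec.lookup s′ g) ∈ T′) →
             IsBlowup H U G T → s ≡ s′
        go {T} refl same s∈ s′∈ b = code-injective (IsBlowup? H U G T) b s∈ s′∈ same

      -- By `encode`, a choice is determined by its hull and a subset of the vertices of `H`, so
      -- each maximal blow-up accounts for at most `2 ^ N` choices.
      count-maximalBlowups : q ^ t ≤ length (maximalBlowups H U G) * 2 ^ N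
      count-maximalBlowups = begin
        q ^ t
          ≡⟨ cong (_^ t) (length-allFin q) ⟨
        length (allFin q) ^ t
          ≡⟨ length-vecs (allFin q) t ⟨
        length (vecs (allFin q) t)
          ≤⟨ length-≤-injectiveOn encode (vecs-unique (Unique.allFin⁺ q) t)
               (λ _ _ → encode-injective)
               (λ {s} _ → ∈-cartesianProduct⁺ (∈-maximalBlowups H U G (proj₂ (proj₂ (hull s))))
                                              (∈-vecs ∈-bools _)) ⟩
        length (cartesianProduct (maximalBlowups H U G) (subsets N))
          ≡⟨ length-cartesianProductWith _,_ (maximalBlowups H U G) (subsets N) ⟩
        length (maximalBlowups H U G) * length (subsets N)
          ≡⟨ cong (length (maximalBlowups H U G) *_) (length-vecs bools N) ⟩
        length (maximalBlowups H U G) * 2 ^ N ∎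
        where open ≤-Reasoning

-- Choice of parameters and final bounds.

module _ {d N : ℕ} (H : Graph N) (connected : Connected H) (maxDegree : MaxDegree≤ H d)
         (2≤N : 2 ≤ N) (E : ℕ) (2d²≤E : 2 * (suc d * suc d) ≤ E) (U : Subset N) where

  private
    q : ℕ
    q = 2 ^ E

    open ClosedNeighbourhoods H

    packing : ∃[ zs ] AllPairs (λ u v → ¬ Close u v) zs × All (λ v → Any (Close v) zs) (allFin N)
    packing = maximal-packing Close? Close-refl (allFin N)

    zs : List (Fin N)
    zs = proj₁ packing

    separated : ∀ {i j} → Close (lookup zs i) (lookup zs j) → i ≡ j
    separated {i} {j} close = [ id , contradiction close ]
      (AllPairs-lookup (λ ¬close → ¬close ∘ Close-sym) (proj₁ (proj₂ packing)) i j)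

    -- One `N` pays for the factor `2 ^ N` lost in the counting; the other is the exponent that
    -- remains.
    2N≤E*t : N + N ≤ E * length zs
    2N≤E*t = begin
      N + N                                     ≡⟨ cong (N +_) (+-identityʳ N) ⟨
      2 * N                                     ≤⟨ *-monoʳ-≤ 2 (length-cover maxDegree (proj₂ (proj₂ packing))) ⟩
      2 * (length zs * (suc d * suc d))         ≡⟨ cong (2 *_) (*-comm (length zs) (suc d * suc d)) ⟩
      2 * (suc d * suc d * length zs)           ≡⟨ *-assoc 2 (suc d * suc d) (length zs) ⟨
      2 * (suc d * suc d) * length zs           ≤⟨ *-monoˡ-≤ (length zs) 2d²≤E ⟩
      E * length zs                             ∎
      where open ≤-Reasoning

    open Coloured H q (length zs) (lookup zs)

    L : List (Subset (N * q))
    L = maximalBlowups H U G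

    2^N≤∣L∣ : 2 ^ N ≤ length L
    2^N≤∣L∣ = *-cancelʳ-≤ (2 ^ N) (length L) (2 ^ N) {{m^n≢0 2 N}} (begin
      2 ^ N * 2 ^ N             ≡⟨ ^-distribˡ-+-* 2 N N ⟨
      2 ^ (N + N)               ≤⟨ ^-monoʳ-≤ 2 2N≤E*t ⟩
      2 ^ (E * length zs)       ≡⟨ ^-*-assoc 2 E (length zs) ⟨
      q ^ length zs            ≤⟨ count-maximalBlowups (fromℕ< (m^n>0 2 E)) separated
                                     (neighbour H connected 2≤N) U ⟩
      length L * 2 ^ N          ∎)
      where open ≤-Reasoning

  -- The last inequality is the bound `2 ^ (m / q)` on the number of sets with the root cleared;
  -- since `m = N * q`, it is the `q`-th power of `2^N≤∣L∣`.
  many-maximal-blowups : Σ ℕ λ m → Σ (Graph m) λ G →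
    N ≤ m × m ≤ 2 ^ E * N × MaxDegree≤ G (d * 2 ^ E)
    × Σ (List (Subset m)) λ L →
    Unique L × All (IsMaximalBlowup H U G) L × 2 ^ m ≤ length L ^ (2 ^ E)
  many-maximal-blowups =
    N * q , G , m≤m*n N q {{m^n≢0 2 E}} , ≤-reflexive (*-comm N q) , G-maxDegree maxDegree ,
    L , maximalBlowups-unique H U G , all-filter (IsMaximalBlowup? H U G) (subsets (N * q)) ,
    (begin
      2 ^ (N * q)      ≡⟨ ^-*-assoc 2 N q ⟨
      (2 ^ N) ^ q      ≤⟨ ^-monoˡ-≤ q 2^N≤∣L∣ ⟩
      length L ^ q     ∎)
    where open ≤-Reasoning

-- Since `2 ≤ d` and `suc d ≤ d ^ 2`, the left side is at most `d ^ 5`.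
2[1+d]²≤d^[21d+20] : ∀ {d} → 2 ≤ d → 2 * (suc d * suc d) ≤ d ^ (21 * d + 20)
2[1+d]²≤d^[21d+20] {d@(suc _)} 2≤d = begin
  2 * (suc d * suc d)       ≤⟨ *-mono-≤ 2≤d (*-mono-≤ 1+d≤d² 1+d≤d²) ⟩
  d * (d ^ 2 * d ^ 2)       ≡⟨ cong (d *_) (^-distribˡ-+-* d 2 2) ⟨
  d ^ 5                     ≤⟨ ^-monoʳ-≤ d (≤-trans (m≤m+n 5 15) (m≤n+m 20 (21 * d))) ⟩
  d ^ (21 * d + 20)         ∎
  where
  open ≤-Reasoning
  1+d≤d² : suc d ≤ d ^ 2
  1+d≤d² = begin
    1 + d       ≤⟨ +-monoˡ-≤ d (<⇒≤ 2≤d) ⟩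
    d + d       ≡⟨ cong (d +_) (+-identityʳ d) ⟨
    2 * d       ≤⟨ *-monoˡ-≤ d 2≤d ⟩
    d * d       ≡⟨ cong (d *_) (*-identityʳ d) ⟨
    d ^ 2       ∎

theorem11 : (d : ℕ) → 2 ≤ d → (N : ℕ) → (H : Graph N) → Connected H → MaxDegree≡ H d
    → d ^ (d ^ (d ^ d)) < N → (U : Subset N)
    → Σ ℕ λ m → Σ (Graph m) λ G →
    N ≤ m × m ≤ (2 ^ (d ^ (21 * d + 20))) * N
    × MaxDegree≤ G (d * 2 ^ (d ^ (21 * d + 20)))
    × Σ (List (Subset m)) λ L →
    Unique L × All (IsMaximalBlowup H U G) L
    × 2 ^ m ≤ length L ^ (2 ^ (d ^ (21 * d + 20)))
theorem11 d@(suc _) 2≤d N H connected (maxDegree , _) N-large U =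
  -- `N` exceeds a positive power of `d`, which gives `2 ≤ N`.
  many-maximal-blowups H connected maxDegree (≤-trans (s≤s (m^n>0 d (d ^ (d ^ d)))) N-large)
    (d ^ (21 * d + 20)) (2[1+d]²≤d^[21d+20] 2≤d) U
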